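{- Let $(\Delta,G,\omega,\zeta)$ be a generalised voltage graph and let $T$ be a spanning tree of $\Delta$. Then there exist a voltage assignment $\zeta'$ and a weight function $\omega'$ (so that $(\Delta,G,\omega',\zeta')$ is a generalised voltage graph) such that $\zeta'(x)=1_G$ for all $x \in D(T)$ and $\mathrm{GenCov}(\Delta,G,\omega,\zeta) \cong \mathrm{GenCov}(\Delta,G,\omega',\zeta')$.
   Context: Graphs. A graph is a quadruple $(V,D,\mathrm{beg},\mathrm{inv})$ where $V$ is a non-empty set of vertices, $D$ is a set of darts (disjoint from $V$), $\mathrm{beg}\colon D\to V$, and $\mathrm{inv}\colon D\to D$ satisfies $\mathrm{inv}\,\mathrm{inv}\,x=x$ for all $x\in D$. For $\Gamma=(V,D,\mathrm{beg},\mathrm{inv})$ write $V(\Gamma)=V$, $D(\Gamma)=D$, $\mathrm{beg}_\Gamma=\mathrm{beg}$, $\mathrm{inv}_\Gamma=\mathrm{inv}$; also $x^{ -1}:=\mathrm{inv}\,x$ and $\mathrm{end}\,x:=\mathrm{beg}\,x^{ -1}$. A walk is a sequence of darts $(x_1,\dots,x_n)$ with $\mathrm{end}\,x_i=\mathrm{beg}\,x_{i+1}$; a walk of length $0$ is regarded as a walk from any vertex to itself. A graph is connected if for any two vertices $u,v$ there is a walk from $u$ to $v$. A subgraph has a subset of the vertices and a subset of the darts, with $\mathrm{beg}$ and $\mathrm{inv}$ restricted; it is spanning if it contains all vertices. A tree is a connected graph with no cycles (in the usual sense; in particular it has no semi-edges $x=x^{ -1}$, no loops and no parallel edges). A spanning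 tree is a spanning subgraph that is a tree. An isomorphism ($\cong$) is a bijection mapping vertices to vertices and darts to darts and commuting with $\mathrm{beg}$ and $\mathrm{inv}$. Generalised voltage graphs. For a group $G$, $S(G)$ is the set of all subgroups of $G$, and $g^h:=h^{ -1}gh$, $H^h:=h^{ -1}Hh$. A generalised voltage graph is a quadruple $(\Delta,G,\omega,\zeta)$ where $\Delta$ is a connected graph, $G$ is a group, and $\omega\colon V(\Delta)\cup D(\Delta)\to S(G)$ (weight function) and $\zeta\colon D(\Delta)\to G$ (voltage assignment) satisfy, for all $x\in D(\Delta)$: $\omega(x)\le\omega(\mathrm{beg}_\Delta x)$; $\omega(x)=\omega(x^{ -1})^{\zeta(x)}$; and $\zeta(x^{ -1})\zeta(x)\in\omega(x)$. Generalised cover. $\mathrm{GenCov}(\Delta,G,\omega,\zeta)$ is the graph $\Gamma$ with $V(\Gamma)=\{(v,\omega(v)g): v\in V(\Delta), g\in G\}$, $D(\Gamma)=\{(x,\omega(x)g): x\in D(\Delta), g\in G\}$, $\mathrm{beg}_\Gamma(x,\omega(x)g)=(\mathrm{beg}_\Delta x,\omega(\mathrm{beg}_\Delta x)g)$ and $\mathrm{inv}_\Gamma(x,\omega(x)g)=(x^{ -1},\omega(x^{ -1})\zeta(x)g)$ (right cosets). -}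

module Defs where

open import Algebra.Bundles using (Group)
open import Data.List using (List; []; _∷_; map)
open import Data.List.Relation.Unary.AllPairs using (AllPairs)
import Data.List.Relation.Unary.Unique.Setoid as UniqueSetoid
open import Data.Product using (Σ; _×_; _,_; proj₁; proj₂; ∃-syntax)
open import Function using (_on_)
open import Function.Bundles using (Bijection)
open import Level using (Level; _⊔_; suc)
open import Relation.Binary.Bundles using (Setoid)
open import Relation.Binary.PropositionalEquality using (_≢_)
import Relation.Binary.Construct.On as On
open import Relation.Nullary using (¬_)
open import Relation.Unary using (Pred; _∈_; _⊆_; _≐_)

-- The sets of vertices and darts are setoids, because the vertices and darts
-- of a generalised cover are cosets.
record Graph (v ℓv d ℓd : Level) : Set (suc (v ⊔ ℓv ⊔ d ⊔ ℓd)) where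
  field
    V : Setoid v ℓv
    D : Setoid d ℓd

  module V = Setoid V
  module D = Setoid D

  field
    nonempty       : V.Carrier
    beg            : D.Carrier → V.Carrier
    inv            : D.Carrier → D.Carrier
    beg-cong       : ∀ {x y} → x D.≈ y → beg x V.≈ beg y
    inv-cong       : ∀ {x y} → x D.≈ y → inv x D.≈ inv y
    inv-involutive : ∀ x → inv (inv x) D.≈ x

  end : D.Carrier → V.Carrier
  end x = beg (inv x)

  data IsWalk : V.Carrier → List D.Carrier → V.Carrier → Set (v ⊔ ℓv ⊔ d) where
    []  : ∀ {u w} → u V.≈ w → IsWalk u [] w
    _∷_ : ∀ {u x xs w} → u V.≈ beg x → IsWalk (end x) xs w → IsWalk u (x ∷ xs) w

  Connected : Set (v ⊔ ℓv ⊔ d)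
  Connected = ∀ u w → ∃[ xs ] IsWalk u xs w

  -- A non-empty closed walk that repeats no vertex and never uses a dart
  -- together with its inverse at another position. The last condition matters
  -- only in length 2, where it rules out going back and forth along one edge.
  -- Semi-edges and loops are cycles of length 1, pairs of parallel edges are
  -- cycles of length 2.
  record IsCycle (xs : List D.Carrier) : Set (v ⊔ ℓv ⊔ d ⊔ ℓd) where
    field
      nontrivial     : xs ≢ []
      closed         : ∃[ u ] IsWalk u xs u
      simple         : UniqueSetoid.Unique V (map beg xs)
      noBacktracking : AllPairs (λ x y → ¬ (y D.≈ inv x)) xs

  IsTree : Set (v ⊔ ℓv ⊔ d ⊔ ℓd)
  IsTree = Connected × (∀ xs → ¬ IsCycle xs)

module _ {v ℓv d ℓd} (Γ : Graph v ℓv d ℓd) where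
  open Graph Γ

  record Subgraph (p q : Level) : Set (v ⊔ ℓv ⊔ d ⊔ ℓd ⊔ suc (p ⊔ q)) where
    field
      VS         : Pred V.Carrier p
      DS         : Pred D.Carrier q
      VS-resp    : ∀ {u w} → u V.≈ w → u ∈ VS → w ∈ VS
      DS-resp    : ∀ {x y} → x D.≈ y → x ∈ DS → y ∈ DS
      nonempty-S : ∃[ u ] u ∈ VS
      beg-closed : ∀ {x} → x ∈ DS → beg x ∈ VS
      inv-closed : ∀ {x} → x ∈ DS → inv x ∈ DS

    toGraph : Graph (v ⊔ p) ℓv (d ⊔ q) ℓd
    toGraph = record
      { V = record { Carrier       = Σ V.Carrier VS
                   ; _≈_           = V._≈_ on proj₁
                   ; isEquivalence = On.isEquivalence proj₁ V.isEquivalence }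
      ; D = record { Carrier       = Σ D.Carrier DS
                   ; _≈_           = D._≈_ on proj₁
                   ; isEquivalence = On.isEquivalence proj₁ D.isEquivalence }
      ; nonempty       = nonempty-S
      ; beg            = λ (x , x∈) → beg x , beg-closed x∈
      ; inv            = λ (x , x∈) → inv x , inv-closed x∈
      ; beg-cong       = beg-cong
      ; inv-cong       = inv-cong
      ; inv-involutive = λ (x , _) → inv-involutive x
      }

    Spanning : Set (v ⊔ p)
    Spanning = ∀ u → u ∈ VS

    IsSpanningTree : Set (v ⊔ ℓv ⊔ d ⊔ ℓd ⊔ p ⊔ q)
    IsSpanningTree = Spanning × Graph.IsTree toGraph

infix 4 _≅_

record _≅_ {v₁ ℓv₁ d₁ ℓd₁ v₂ ℓv₂ d₂ ℓd₂}
           (Γ₁ : Graph v₁ ℓv₁ d₁ ℓd₁) (Γ₂ : Graph v₂ ℓv₂ d₂ ℓd₂)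
           : Set (v₁ ⊔ ℓv₁ ⊔ d₁ ⊔ ℓd₁ ⊔ v₂ ⊔ ℓv₂ ⊔ d₂ ⊔ ℓd₂) where
  private
    module Γ₁ = Graph Γ₁
    module Γ₂ = Graph Γ₂
  field
    onV : Bijection Γ₁.V Γ₂.V
    onD : Bijection Γ₁.D Γ₂.D

  private
    module onV = Bijection onV
    module onD = Bijection onD
  field
    beg-commutes : ∀ x → onV.to (Γ₁.beg x) Γ₂.V.≈ Γ₂.beg (onD.to x)
    inv-commutes : ∀ x → onD.to (Γ₁.inv x) Γ₂.D.≈ Γ₂.inv (onD.to x)

module _ {c ℓ} (G : Group c ℓ) where
  open Group G

  record Subgroup (s : Level) : Set (c ⊔ ℓ ⊔ suc s) where
    field
      set       : Pred Carrier s
      resp      : ∀ {g h} → g ≈ h → g ∈ set → h ∈ set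
      ε-closed  : ε ∈ set
      ∙-closed  : ∀ {g h} → g ∈ set → h ∈ set → g ∙ h ∈ set
      ⁻¹-closed : ∀ {g} → g ∈ set → g ⁻¹ ∈ set

  open Subgroup

  -- H^g = g⁻¹Hg
  conjugate : ∀ {s} → Pred Carrier s → Carrier → Pred Carrier (c ⊔ ℓ ⊔ s)
  conjugate H g a = ∃[ h ] h ∈ H × a ≈ g ⁻¹ ∙ h ∙ g

  rightCoset : ∀ {s} → Pred Carrier s → Carrier → Pred Carrier (c ⊔ ℓ ⊔ s)
  rightCoset H g a = ∃[ h ] h ∈ H × a ≈ h ∙ g

  module _ {s} (H K : Subgroup s) where

    rightCoset-≐⁺ : ∀ {g g′} → set H ≐ set K → g ∈ rightCoset (set K) g′ →
                    rightCoset (set H) g ≐ rightCoset (set K) g′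
    rightCoset-≐⁺ {g} {g′} (H⊆K , K⊆H) (k , k∈K , g≈kg′) =
      (λ (h , h∈H , a≈hg) →
         h ∙ k , ∙-closed K (H⊆K h∈H) k∈K ,
         trans a≈hg (trans (∙-congˡ g≈kg′) (sym (assoc h k g′)))) ,
      (λ (k′ , k′∈K , a≈k′g′) →
         k′ ∙ k ⁻¹ , K⊆H (∙-closed K k′∈K (⁻¹-closed K k∈K)) ,
         trans a≈k′g′ (trans (∙-congˡ g′≈k⁻¹g) (sym (assoc k′ (k ⁻¹) g))))
      where
      g′≈k⁻¹g : g′ ≈ k ⁻¹ ∙ g
      g′≈k⁻¹g = trans (sym (identityˡ g′))
               (trans (∙-congʳ (sym (inverseˡ k)))
               (trans (assoc (k ⁻¹) k g′) (∙-congˡ (sym g≈kg′))))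

    rightCoset-≐⁻ : ∀ {g g′} → rightCoset (set H) g ≐ rightCoset (set K) g′ →
                    g ∈ rightCoset (set K) g′
    rightCoset-≐⁻ {g} (Hg⊆Kg′ , _) = Hg⊆Kg′ (ε , ε-closed H , sym (identityˡ g))

module _ {v ℓv d ℓd c ℓ} (Δ : Graph v ℓv d ℓd) (G : Group c ℓ) where
  open Graph Δ
  open Group G

  -- The weight function on V(Δ) ∪ D(Δ) is split into ωV and ωD.
  record GenVoltageGraph (s : Level)
         : Set (v ⊔ ℓv ⊔ d ⊔ ℓd ⊔ c ⊔ ℓ ⊔ suc s) where
    field
      connected : Connected
      ωV        : V.Carrier → Subgroup G s
      ωD        : D.Carrier → Subgroup G s
      ζ         : D.Carrier → Carrier

    ⟨ωV⟩ : V.Carrier → Pred Carrier s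
    ⟨ωV⟩ u = Subgroup.set (ωV u)

    ⟨ωD⟩ : D.Carrier → Pred Carrier s
    ⟨ωD⟩ x = Subgroup.set (ωD x)

    field
      ωV-cong  : ∀ {u w} → u V.≈ w → ⟨ωV⟩ u ≐ ⟨ωV⟩ w
      ωD-cong  : ∀ {x y} → x D.≈ y → ⟨ωD⟩ x ≐ ⟨ωD⟩ y
      ζ-cong   : ∀ {x y} → x D.≈ y → ζ x ≈ ζ y
      ωD⊆ωV    : ∀ x → ⟨ωD⟩ x ⊆ ⟨ωV⟩ (beg x)
      ωD-conj  : ∀ x → ⟨ωD⟩ x ≐ conjugate G (⟨ωD⟩ (inv x)) (ζ x)
      ζ-inv    : ∀ x → ζ (inv x) ∙ ζ x ∈ ⟨ωD⟩ x

module _ {v ℓv d ℓd c ℓ s} {Δ : Graph v ℓv d ℓd} {G : Group c ℓ}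
         (𝒱 : GenVoltageGraph Δ G s) where
  open Graph Δ
  open Group G
  open GenVoltageGraph 𝒱

  -- The pair (u , g) stands for (u , ω(u)g), and likewise for darts; equality
  -- of pairs is equality in the base together with equality of the cosets.
  GenCov : Graph (v ⊔ c) (ℓv ⊔ c ⊔ ℓ ⊔ s) (d ⊔ c) (ℓd ⊔ c ⊔ ℓ ⊔ s)
  GenCov = record
    { V = record
        { Carrier = V.Carrier × Carrier
        ; _≈_ = λ (u , g) (w , h) →
            u V.≈ w × rightCoset G (⟨ωV⟩ u) g ≐ rightCoset G (⟨ωV⟩ w) h
        ; isEquivalence = record
            { refl  = V.refl , (λ a∈ → a∈) , (λ a∈ → a∈)
            ; sym   = λ (p , f , g) → V.sym p , g , f
            ; trans = λ (p , f , g) (q , f′ , g′) →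
                V.trans p q , (λ a∈ → f′ (f a∈)) , (λ a∈ → g (g′ a∈)) } }
    ; D = record
        { Carrier = D.Carrier × Carrier
        ; _≈_ = λ (x , g) (y , h) →
            x D.≈ y × rightCoset G (⟨ωD⟩ x) g ≐ rightCoset G (⟨ωD⟩ y) h
        ; isEquivalence = record
            { refl  = D.refl , (λ a∈ → a∈) , (λ a∈ → a∈)
            ; sym   = λ (p , f , g) → D.sym p , g , f
            ; trans = λ (p , f , g) (q , f′ , g′) →
                D.trans p q , (λ a∈ → f′ (f a∈)) , (λ a∈ → g (g′ a∈)) } }
    ; nonempty = nonempty , ε
    ; beg = λ (x , g) → beg x , g
    ; inv = λ (x , g) → inv x , ζ x ∙ g
    ; beg-cong = λ { {x , _} {y , _} (x≈y , eq) → beg-cong x≈y ,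
        rightCoset-≐⁺ G (ωV (beg x)) (ωV (beg y)) (ωV-cong (beg-cong x≈y))
          (let (k , k∈ , e) = rightCoset-≐⁻ G (ωD x) (ωD y) eq
           in k , ωD⊆ωV y k∈ , e) }
    ; inv-cong = λ { {x , g} {y , h} (x≈y , eq) → inv-cong x≈y ,
        rightCoset-≐⁺ G (ωD (inv x)) (ωD (inv y)) (ωD-cong (inv-cong x≈y))
          (let (k , k∈ , g≈kh)      = rightCoset-≐⁻ G (ωD x) (ωD y) eq
               (m , m∈ , k≈ζ⁻¹mζ) = proj₁ (ωD-conj y) k∈
           in m , m∈ , trans (∙-cong (ζ-cong x≈y) g≈kh) (shift k≈ζ⁻¹mζ)) }
    ; inv-involutive = λ (x , g) → inv-involutive x ,
        rightCoset-≐⁺ G (ωD (inv (inv x))) (ωD x) (ωD-cong (inv-involutive x))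
          (ζ (inv x) ∙ ζ x , ζ-inv x , sym (assoc _ _ _))
    }
    where
    shift : ∀ {z k m h} → k ≈ z ⁻¹ ∙ m ∙ z → z ∙ (k ∙ h) ≈ m ∙ (z ∙ h)
    shift {z} {k} {m} {h} k≈ =
      trans (sym (assoc z k h)) (trans (∙-congʳ zk≈mz) (assoc m z h))
      where
      zk≈mz : z ∙ k ≈ m ∙ z
      zk≈mz = trans (∙-congˡ (trans k≈ (assoc (z ⁻¹) m z)))
             (trans (sym (assoc z (z ⁻¹) (m ∙ z)))
             (trans (∙-congʳ (inverseʳ z)) (identityˡ (m ∙ z))))

{-# OPTIONS --safe #-}
module Submission where

-- Relabel the coset ω(u)g over u as f(u)⁻¹ω(u)g for a potential f on the vertices.
-- This conjugates the weights by f and turns ζ(x) into f(end x)⁻¹ ζ(x) f(beg x),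
-- which may be replaced by 1 wherever it lies in the new weight of x⁻¹. On the tree
-- let f(u) be the product of the voltages along the reduced walk between u and a
-- root. That walk is unique, so the reduced walks of the two ends of a tree dart x
-- differ by x or x⁻¹ only. The product ζ(x⁻¹)ζ(x) need not be trivial, but it lies in
-- ω(x), so f is a suitable potential whichever end of x is nearer to the root.

open import Defs
open import Algebra.Bundles using (Group)
import Algebra.Properties.Group as GroupProperties
open import Axiom.ExcludedMiddle using (ExcludedMiddle)
open import Data.List using (List; []; _∷_; map; foldr; _ʳ++_; reverse)
open import Data.List.Properties using (ʳ++-defn; ++-conicalʳ)
open import Data.List.Relation.Binary.Pointwise using (Pointwise; []; _∷_)
open import Data.List.Relation.Unary.All as All using (All; []; _∷_)
open import Data.List.Relation.Unary.All.Properties using (¬Any⇒All¬; All¬⇒¬Any)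
open import Data.List.Relation.Unary.AllPairs using (AllPairs; []; _∷_)
import Data.List.Relation.Unary.AllPairs.Properties as AllPairs
open import Data.List.Relation.Unary.Any as Any using (Any; here; there)
open import Data.List.Relation.Unary.Linked as Linked using (Linked; []; [-]; _∷_)
open import Data.Product using (_×_; _,_; proj₁; proj₂; ∃-syntax; Σ-syntax)
open import Data.Sum using (_⊎_; inj₁; inj₂; [_,_]′)
open import Function using (_∘_)
open import Function.Definitions using (Bijective)
open import Level using (Level)
open import Relation.Binary.Bundles using (Setoid)
open import Relation.Binary.Definitions using (Decidable)
open import Relation.Binary.PropositionalEquality as ≡ using (_≡_)
import Relation.Binary.Reasoning.Setoid as SetoidReasoning
open import Relation.Nullary using (¬_; yes; no; contradiction)
open import Relation.Unary using (_∈_; _⊆_; _≐_)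

-- Reduced walks and their uniqueness in graphs without cycles.

module ReducedWalks {v ℓv d ℓd} (Γ : Graph v ℓv d ℓd) where
  open Graph Γ

  -- The condition is local, so it passes to tails and to glued walks; `IsCycle` asks for it at all
  -- pairs of positions.
  Reduced : List D.Carrier → Set _
  Reduced = Linked (λ x y → ¬ (y D.≈ inv x))

  DistinctBegs : List D.Carrier → Set _
  DistinctBegs = AllPairs (λ x y → ¬ (beg x V.≈ beg y))

  Avoids : V.Carrier → List D.Carrier → Set _
  Avoids u = All (λ x → ¬ (u V.≈ beg x))

  walk-respˡ : ∀ {u u′ xs w} → u V.≈ u′ → IsWalk u xs w → IsWalk u′ xs w
  walk-respˡ u≈u′ ([] u≈w)    = [] (V.trans (V.sym u≈u′) u≈w)
  walk-respˡ u≈u′ (u≈bx ∷ xs) = V.trans (V.sym u≈u′) u≈bx ∷ xs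

  walk-respʳ : ∀ {u xs w w′} → w V.≈ w′ → IsWalk u xs w → IsWalk u xs w′
  walk-respʳ w≈w′ ([] u≈w)    = [] (V.trans u≈w w≈w′)
  walk-respʳ w≈w′ (u≈bx ∷ xs) = u≈bx ∷ walk-respʳ w≈w′ xs

  -- `x₀` is the dart before the walk, carried along so that the prefix can follow it again without
  -- backtracking. The last component keeps the beginnings distinct when a dart is put back in
  -- front.
  prefixUntil : ∀ {u xs t w x₀} →
    IsWalk u xs t → Reduced (x₀ ∷ xs) → DistinctBegs xs →
    Any (λ x → w V.≈ beg x) xs →
    ∃[ ys ] IsWalk u ys w × Reduced (x₀ ∷ ys) × DistinctBegs ys × Avoids w ys
            × (∀ {v} → Avoids v xs → Avoids v ys)
  prefixUntil (u≈bx ∷ _) _ _ (here w≈bx) =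
    [] , [] (V.trans u≈bx (V.sym w≈bx)) , [-] , [] , [] , λ _ → []
  prefixUntil {xs = x ∷ _} (u≈bx ∷ xs-walk) (r ∷ red) (bx≉ ∷ dist) (there w∈) =
    let ys , ys-walk , ys-red , ys-dist , w∉ , sub = prefixUntil xs-walk red dist w∈
    in x ∷ ys , u≈bx ∷ ys-walk , r ∷ ys-red , sub bx≉ ∷ ys-dist ,
       (λ w≈bx → All¬⇒¬Any bx≉ (Any.map (V.trans (V.sym w≈bx)) w∈)) ∷ w∉ ,
       λ { (v≉ ∷ v∉) → v≉ ∷ sub v∉ }

  -- Adjacent darts are covered by `Reduced`. A later dart equal to `inv x` would begin where `x`
  -- ends, which is where `y` begins, against `DistinctBegs`.
  noBacktracking : ∀ {u xs w} → IsWalk u xs w → Reduced xs → DistinctBegs xs →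
                   AllPairs (λ x y → ¬ (y D.≈ inv x)) xs
  noBacktracking {xs = []} _ _ _ = []
  noBacktracking {xs = _ ∷ []} _ _ _ = [] ∷ []
  noBacktracking {xs = x ∷ y ∷ _} (_ ∷ walk@(ex≈by ∷ _)) (r ∷ red) (_ ∷ dist@(by≉ ∷ _)) =
    (r ∷ All.map (λ by≉bz z≈x⁻¹ →
                    by≉bz (V.trans (V.sym ex≈by) (V.sym (beg-cong z≈x⁻¹)))) by≉)
    ∷ noBacktracking walk red dist

  module _ (acyclic : ∀ xs → ¬ IsCycle xs) where

    noSimpleClosedWalk : ∀ {u x xs} → IsWalk u (x ∷ xs) u → Reduced (x ∷ xs) →
                         ¬ DistinctBegs (x ∷ xs)
    noSimpleClosedWalk walk red dist = acyclic _ record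
      { nontrivial     = λ ()
      ; closed         = _ , walk
      ; simple         = AllPairs.map⁺ dist
      ; noBacktracking = noBacktracking walk red dist
      }

    -- If the first vertex reappears, the prefix up to its first reappearance is
    -- a cycle, because the remaining vertices are distinct by induction.
    reduced⇒simple : ∀ {u xs t} → IsWalk u xs t → Reduced xs →
                     DistinctBegs xs × Avoids t xs
    reduced⇒simple {xs = []} _ _ = [] , []
    reduced⇒simple {xs = x ∷ xs} (u≈bx ∷ walk) red =
      let dist , t∉ = reduced⇒simple walk (Linked.tail red)
          bx∉ = ¬Any⇒All¬ xs λ bx∈ →
            let _ , ys-walk , ys-red , ys-dist , bx∉ys , _ = prefixUntil walk red dist bx∈
            in noSimpleClosedWalk (V.refl ∷ ys-walk) ys-red (bx∉ys ∷ ys-dist)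
      in bx∉ ∷ dist ,
         (λ t≈bx → noSimpleClosedWalk (V.refl ∷ walk-respʳ t≈bx walk) red (bx∉ ∷ dist)) ∷ t∉

    -- By `reduced⇒simple` the walk never ends at the beginning of one of its darts, but a non-empty
    -- closed walk ends at the beginning of its first dart.
    closedReduced⇒[] : ∀ {u xs} → IsWalk u xs u → Reduced xs → xs ≡ []
    closedReduced⇒[] {xs = []} _ _ = ≡.refl
    closedReduced⇒[] {xs = _ ∷ _} walk@(u≈bx ∷ _) red
      with _ , u≉bx ∷ _ ← reduced⇒simple walk red = contradiction u≈bx u≉bx

  reverse-walk : ∀ {u xs t ys w} → IsWalk u xs t → IsWalk u ys w →
                 IsWalk t (map inv xs ʳ++ ys) w
  reverse-walk ([] u≈t) ys = walk-respˡ u≈t ys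
  reverse-walk {xs = x ∷ _} (u≈bx ∷ xs) ys = reverse-walk xs
    (V.refl ∷ walk-respˡ (V.trans u≈bx (V.sym (beg-cong (inv-involutive x)))) ys)

  -- Each turn of the reversed part is reduced because the original turn is; the hypothesis on
  -- `inv x ∷ ys` covers the place where the two walks are glued.
  reverse-reduced : ∀ {x xs ys} → Reduced (x ∷ xs) → Reduced (inv x ∷ ys) →
                    Reduced (map inv (x ∷ xs) ʳ++ ys)
  reverse-reduced [-] ys = ys
  reverse-reduced (y≉x⁻¹ ∷ xs) ys = reverse-reduced xs
    ((λ x⁻¹≈y⁻¹⁻¹ → y≉x⁻¹ (D.sym (D.trans x⁻¹≈y⁻¹⁻¹ (inv-involutive _)))) ∷ ys)

  module _ (_≟_ : Decidable D._≈_) where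

    -- This is multiplication by a generator on reduced words, so folding it over a walk is free
    -- reduction.
    cons : D.Carrier → List D.Carrier → List D.Carrier
    cons x []       = x ∷ []
    cons x (y ∷ ys) with y ≟ inv x
    ... | yes _ = ys
    ... | no _  = x ∷ y ∷ ys

    cons-walk : ∀ {u x ys w} → u V.≈ beg x → IsWalk (end x) ys w → IsWalk u (cons x ys) w
    cons-walk {ys = []} u≈bx walk = u≈bx ∷ walk
    cons-walk {x = x} {y ∷ _} u≈bx walk@(_ ∷ walk′) with y ≟ inv x
    ... | yes y≈x⁻¹ = walk-respˡ
          (V.trans (beg-cong (D.trans (inv-cong y≈x⁻¹) (inv-involutive x))) (V.sym u≈bx)) walk′
    ... | no _      = u≈bx ∷ walk

    cons-reduced : ∀ {x ys} → Reduced ys → Reduced (cons x ys)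
    cons-reduced {ys = []} _ = [-]
    cons-reduced {x} {y ∷ _} red with y ≟ inv x
    ... | yes _    = Linked.tail red
    ... | no y≉x⁻¹ = y≉x⁻¹ ∷ red

    reduce : List D.Carrier → List D.Carrier
    reduce = foldr cons []

    reduce-walk : ∀ {u xs w} → IsWalk u xs w → IsWalk u (reduce xs) w
    reduce-walk ([] u≈w)    = [] u≈w
    reduce-walk (u≈bx ∷ xs) = cons-walk u≈bx (reduce-walk xs)

    reduce-reduced : ∀ xs → Reduced (reduce xs)
    reduce-reduced []       = []
    reduce-reduced (_ ∷ xs) = cons-reduced (reduce-reduced xs)

    -- Common initial darts are stripped. If one walk runs out, the rest of the other is closed; if
    -- the first darts differ, the reverse of one walk followed by the other is closed and reduced.
    -- `closedReduced⇒[]` applies in both cases.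
    reducedWalk-unique : (∀ xs → ¬ IsCycle xs) → ∀ {u xs ys w} →
                         IsWalk u xs w → Reduced xs → IsWalk u ys w → Reduced ys →
                         Pointwise D._≈_ xs ys
    reducedWalk-unique acyclic {xs = []} {[]} _ _ _ _ = []
    reducedWalk-unique acyclic {xs = []} {_ ∷ _} ([] u≈w) _ ys-walk ys-red
      with () ← closedReduced⇒[] acyclic (walk-respʳ (V.sym u≈w) ys-walk) ys-red
    reducedWalk-unique acyclic {xs = _ ∷ _} {[]} xs-walk xs-red ([] u≈w) _
      with () ← closedReduced⇒[] acyclic (walk-respʳ (V.sym u≈w) xs-walk) xs-red
    reducedWalk-unique acyclic {xs = x ∷ xs} {y ∷ ys}
      xs-walk@(_ ∷ xs-walk′) xs-red ys-walk@(_ ∷ ys-walk′) ys-red with x ≟ y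
    ... | yes x≈y = x≈y ∷ reducedWalk-unique acyclic xs-walk′ (Linked.tail xs-red)
            (walk-respˡ (V.sym (beg-cong (inv-cong x≈y))) ys-walk′) (Linked.tail ys-red)
    -- The glued walk has the non-empty final segment `inv x ∷ y ∷ ys`. Backtracking at its junction
    -- would make `y` equal to `inv (inv x)`, hence to `x`.
    ... | no x≉y = contradiction
            (++-conicalʳ (reverse (map inv xs)) _
              (≡.trans (≡.sym (ʳ++-defn (map inv xs)))
                (closedReduced⇒[] acyclic (reverse-walk xs-walk ys-walk)
                  (reverse-reduced xs-red
                    ((λ y≈x⁻¹⁻¹ → x≉y (D.sym (D.trans y≈x⁻¹⁻¹ (inv-involutive x)))) ∷ ys-red)))))
            λ ()

-- Conjugation in a group and conjugate subgroups.

module Conjugation {c ℓ} (G : Group c ℓ) where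
  open Group G
  open GroupProperties G
  open SetoidReasoning setoid

  infixr 7.5 _▷_

  -- Opposite in direction to `conjugate`: an element `a` lies in H^z when `z ▷ a` lies in H. The
  -- precedence is between those of `∙` and `⁻¹`.
  _▷_ : Carrier → Carrier → Carrier
  z ▷ a = z ∙ a ∙ z ⁻¹

  ▷-cong : ∀ {y z a b} → y ≈ z → a ≈ b → y ▷ a ≈ z ▷ b
  ▷-cong y≈z a≈b = ∙-cong (∙-cong y≈z a≈b) (⁻¹-cong y≈z)

  -- Clears the outer inverse, so that identities between conjugates can be checked as commutation
  -- rules.
  za≈bz⇒z▷a≈b : ∀ {z a b} → z ∙ a ≈ b ∙ z → z ▷ a ≈ b
  za≈bz⇒z▷a≈b {z} {a} {b} eq = trans (∙-congʳ eq) (//-rightDividesʳ z b)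

  z▷a∙z≈za : ∀ z a → z ▷ a ∙ z ≈ z ∙ a
  z▷a∙z≈za z a = //-rightDividesˡ z (z ∙ a)

  ▷-homo-∙ : ∀ z a b → z ▷ (a ∙ b) ≈ z ▷ a ∙ z ▷ b
  ▷-homo-∙ z a b = za≈bz⇒z▷a≈b (begin
    z ∙ (a ∙ b)           ≈⟨ assoc z a b ⟨
    z ∙ a ∙ b             ≈⟨ ∙-congʳ (z▷a∙z≈za z a) ⟨
    z ▷ a ∙ z ∙ b         ≈⟨ assoc _ _ _ ⟩
    z ▷ a ∙ (z ∙ b)       ≈⟨ ∙-congˡ (z▷a∙z≈za z b) ⟨
    z ▷ a ∙ (z ▷ b ∙ z)   ≈⟨ assoc _ _ _ ⟨
    z ▷ a ∙ z ▷ b ∙ z     ∎)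

  ▷-homo-ε : ∀ z → z ▷ ε ≈ ε
  ▷-homo-ε z = za≈bz⇒z▷a≈b (trans (identityʳ z) (sym (identityˡ z)))

  ▷-homo-⁻¹ : ∀ z a → z ▷ a ⁻¹ ≈ (z ▷ a) ⁻¹
  ▷-homo-⁻¹ z a = inverseˡ-unique _ _ (begin
    z ▷ a ⁻¹ ∙ z ▷ a   ≈⟨ ▷-homo-∙ z _ _ ⟨
    z ▷ (a ⁻¹ ∙ a)     ≈⟨ ▷-cong refl (inverseˡ a) ⟩
    z ▷ ε              ≈⟨ ▷-homo-ε z ⟩
    ε                  ∎)

  ▷-comp : ∀ y z a → (y ∙ z) ▷ a ≈ y ▷ z ▷ a
  ▷-comp y z a = za≈bz⇒z▷a≈b (begin
    y ∙ z ∙ a               ≈⟨ assoc y z a ⟩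
    y ∙ (z ∙ a)             ≈⟨ ∙-congˡ (z▷a∙z≈za z a) ⟨
    y ∙ (z ▷ a ∙ z)         ≈⟨ assoc _ _ _ ⟨
    y ∙ z ▷ a ∙ z           ≈⟨ ∙-congʳ (z▷a∙z≈za y _) ⟨
    y ▷ z ▷ a ∙ y ∙ z       ≈⟨ assoc _ _ _ ⟩
    y ▷ z ▷ a ∙ (y ∙ z)     ∎)

  ▷-identity : ∀ a → ε ▷ a ≈ a
  ▷-identity a = za≈bz⇒z▷a≈b (trans (identityˡ a) (sym (identityʳ a)))

  z⁻¹▷z▷a≈a : ∀ z a → z ⁻¹ ▷ z ▷ a ≈ a
  z⁻¹▷z▷a≈a z a = begin
    z ⁻¹ ▷ z ▷ a     ≈⟨ ▷-comp (z ⁻¹) z a ⟨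
    (z ⁻¹ ∙ z) ▷ a   ≈⟨ ▷-cong (inverseˡ z) refl ⟩
    ε ▷ a            ≈⟨ ▷-identity a ⟩
    a                ∎

  z▷z⁻¹▷a≈a : ∀ z a → z ▷ z ⁻¹ ▷ a ≈ a
  z▷z⁻¹▷a≈a z a = begin
    z ▷ z ⁻¹ ▷ a     ≈⟨ ▷-comp z (z ⁻¹) a ⟨
    (z ∙ z ⁻¹) ▷ a   ≈⟨ ▷-cong (inverseʳ z) refl ⟩
    ε ▷ a            ≈⟨ ▷-identity a ⟩
    a                ∎

  -- A preimage under conjugation, since the existential in `conjugate` would raise the level and
  -- the new weights must stay in `Subgroup G s`.
  _^_ : ∀ {s} → Subgroup G s → Carrier → Subgroup G s
  H ^ z = record
    { set       = λ a → z ▷ a ∈ set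
    ; resp      = λ a≈b → resp (▷-cong refl a≈b)
    ; ε-closed  = resp (sym (▷-homo-ε z)) ε-closed
    ; ∙-closed  = λ a∈ b∈ → resp (sym (▷-homo-∙ z _ _)) (∙-closed a∈ b∈)
    ; ⁻¹-closed = λ a∈ → resp (sym (▷-homo-⁻¹ z _)) (⁻¹-closed a∈)
    }
    where open Subgroup H

  module _ {s} (H : Subgroup G s) where
    open Subgroup H

    ∈-conjugate⁺ : ∀ {z a} → z ▷ a ∈ set → a ∈ conjugate G set z
    ∈-conjugate⁺ {z} {a} z▷a∈H = z ▷ a , z▷a∈H , (begin
      a                      ≈⟨ \\-leftDividesʳ z a ⟨
      z ⁻¹ ∙ (z ∙ a)         ≈⟨ ∙-congˡ (z▷a∙z≈za z a) ⟨
      z ⁻¹ ∙ (z ▷ a ∙ z)     ≈⟨ assoc _ _ _ ⟨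
      z ⁻¹ ∙ z ▷ a ∙ z       ∎)

    ∈-conjugate⁻ : ∀ {z a} → a ∈ conjugate G set z → z ▷ a ∈ set
    ∈-conjugate⁻ {z} {a} (h , h∈H , a≈z⁻¹hz) = resp (sym (za≈bz⇒z▷a≈b (begin
      z ∙ a                ≈⟨ ∙-congˡ a≈z⁻¹hz ⟩
      z ∙ (z ⁻¹ ∙ h ∙ z)   ≈⟨ assoc _ _ _ ⟨
      z ∙ (z ⁻¹ ∙ h) ∙ z   ≈⟨ ∙-congʳ (\\-leftDividesˡ z h) ⟩
      h ∙ z                ∎))) h∈H

    ▷-closed : ∀ {m a} → m ∈ set → a ∈ set → m ▷ a ∈ set
    ▷-closed m∈H a∈H = ∙-closed (∙-closed m∈H a∈H) (⁻¹-closed m∈H)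

    ▷-closed⁻ : ∀ {m a} → m ∈ set → m ▷ a ∈ set → a ∈ set
    ▷-closed⁻ {m} {a} m∈H m▷a∈H =
      resp (z⁻¹▷z▷a≈a m a) (▷-closed (⁻¹-closed m∈H) m▷a∈H)

    -- This is z⁻¹Hh = (z⁻¹Hz)z⁻¹h. Both `y` and `z` occur because a potential takes values at equal
    -- vertices that are only `≈`.
    ∈-rightCoset-^⁺ : ∀ {y z g h} → y ≈ z → g ∈ rightCoset G set h →
                      y ⁻¹ ∙ g ∈ rightCoset G (Subgroup.set (H ^ z)) (z ⁻¹ ∙ h)
    ∈-rightCoset-^⁺ {y} {z} {g} {h} y≈z (k , k∈H , g≈kh) =
      z ⁻¹ ▷ k , resp (sym (z▷z⁻¹▷a≈a z k)) k∈H , (begin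
        y ⁻¹ ∙ g                   ≈⟨ ∙-cong (⁻¹-cong y≈z) g≈kh ⟩
        z ⁻¹ ∙ (k ∙ h)             ≈⟨ assoc _ _ _ ⟨
        z ⁻¹ ∙ k ∙ h               ≈⟨ ∙-congʳ (z▷a∙z≈za (z ⁻¹) k) ⟨
        z ⁻¹ ▷ k ∙ z ⁻¹ ∙ h        ≈⟨ assoc _ _ _ ⟩
        z ⁻¹ ▷ k ∙ (z ⁻¹ ∙ h)      ∎)

    ∈-rightCoset-^⁻ : ∀ {y z g h} → y ≈ z →
                      y ⁻¹ ∙ g ∈ rightCoset G (Subgroup.set (H ^ z)) (z ⁻¹ ∙ h) →
                      g ∈ rightCoset G set h
    ∈-rightCoset-^⁻ {y} {z} {g} {h} y≈z (k , z▷k∈H , y⁻¹g≈kz⁻¹h) =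
      z ▷ k , z▷k∈H , (begin
        g                            ≈⟨ \\-leftDividesˡ y g ⟨
        y ∙ (y ⁻¹ ∙ g)               ≈⟨ ∙-cong y≈z y⁻¹g≈kz⁻¹h ⟩
        z ∙ (k ∙ (z ⁻¹ ∙ h))         ≈⟨ assoc _ _ _ ⟨
        z ∙ k ∙ (z ⁻¹ ∙ h)           ≈⟨ ∙-congʳ (z▷a∙z≈za z k) ⟨
        z ▷ k ∙ z ∙ (z ⁻¹ ∙ h)       ≈⟨ assoc _ _ _ ⟩
        z ▷ k ∙ (z ∙ (z ⁻¹ ∙ h))     ≈⟨ ∙-congˡ (\\-leftDividesˡ z h) ⟩
        z ▷ k ∙ h                    ∎)

  ^-cong : ∀ {s y z} {H K : Subgroup G s} → y ≈ z →
           Subgroup.set H ⊆ Subgroup.set K → Subgroup.set (H ^ y) ⊆ Subgroup.set (K ^ z)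
  ^-cong {K = K} y≈z H⊆K a∈ = Subgroup.resp K (▷-cong y≈z refl) (H⊆K a∈)

-- Left translation of cosets over a setoid, for vertices and darts alike.

module CosetTranslation
  {a ℓa c ℓ s} (S : Setoid a ℓa) (G : Group c ℓ)
  (ω : Setoid.Carrier S → Subgroup G s)
  (ω-cong : ∀ {u w} → Setoid._≈_ S u w → Subgroup.set (ω u) ≐ Subgroup.set (ω w))
  (f : Setoid.Carrier S → Group.Carrier G)
  (f-cong : ∀ {u w} → Setoid._≈_ S u w → Group._≈_ G (f u) (f w))
  where
  private module S = Setoid S
  open Group G
  open GroupProperties G
  open Conjugation G

  -- Unfolds to the equality of vertices or of darts in `GenCov`, so the bijection below serves
  -- directly in the isomorphism.
  CosetEq : (S.Carrier → Subgroup G s) → S.Carrier × Carrier → S.Carrier × Carrier → Set _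
  CosetEq ρ (u , g) (w , h) =
    u S.≈ w × rightCoset G (Subgroup.set (ρ u)) g ≐ rightCoset G (Subgroup.set (ρ w)) h

  ω′ : S.Carrier → Subgroup G s
  ω′ u = ω u ^ f u

  ω′-cong : ∀ {u w} → u S.≈ w → Subgroup.set (ω′ u) ≐ Subgroup.set (ω′ w)
  ω′-cong {u} {w} u≈w =
    ^-cong {H = ω u} {ω w} (f-cong u≈w) (proj₁ (ω-cong u≈w)) ,
    ^-cong {H = ω w} {ω u} (sym (f-cong u≈w)) (proj₂ (ω-cong u≈w))

  translate : S.Carrier × Carrier → S.Carrier × Carrier
  translate (u , g) = u , f u ⁻¹ ∙ g

  translate-cong : ∀ {x y} → CosetEq ω x y → CosetEq ω′ (translate x) (translate y)
  translate-cong {u , g} {w , h} (u≈w , eq) = u≈w ,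
    rightCoset-≐⁺ G (ω′ u) (ω′ w) (ω′-cong u≈w)
      (∈-rightCoset-^⁺ (ω w) (f-cong u≈w) (rightCoset-≐⁻ G (ω u) (ω w) eq))

  translate-bijective : Bijective (CosetEq ω) (CosetEq ω′) translate
  translate-bijective =
    (λ { {u , g} {w , h} (u≈w , eq) → u≈w ,
         rightCoset-≐⁺ G (ω u) (ω w) (ω-cong u≈w)
           (∈-rightCoset-^⁻ (ω w) (f-cong u≈w) (rightCoset-≐⁻ G (ω′ u) (ω′ w) eq)) }) ,
    (λ { (w , h) → (w , f w ∙ h) , λ { {u , g} (u≈w , eq) → u≈w ,
         rightCoset-≐⁺ G (ω′ u) (ω′ w) (ω′-cong u≈w)
           (let k , k∈ , e = ∈-rightCoset-^⁺ (ω w) (f-cong u≈w) (rightCoset-≐⁻ G (ω u) (ω w) eq)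
            in k , k∈ , trans e (∙-congˡ (\\-leftDividesʳ (f w) h))) } })

-- Gauge transformations of a generalised voltage graph.

module Gauge
  {v ℓv d ℓd c ℓ s} {Δ : Graph v ℓv d ℓd} {G : Group c ℓ} (𝒱 : GenVoltageGraph Δ G s)
  where
  open Graph Δ
  open Group G
  open GenVoltageGraph 𝒱
  open GroupProperties G
  open Conjugation G
  open SetoidReasoning setoid

  -- A gauge transformation by f multiplies the coset over u by f(u)⁻¹. The new
  -- voltages only have to agree with f(end x)⁻¹ ζ(x) f(beg x) up to an element of
  -- the new weight of x⁻¹.
  module Transform
    (f       : V.Carrier → Carrier)
    (f-cong  : ∀ {u w} → u V.≈ w → f u ≈ f w)
    (ζ′      : D.Carrier → Carrier)
    (ζ′-cong : ∀ {x y} → x D.≈ y → ζ′ x ≈ ζ′ y)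
    (f∙ζ′    : ∀ x → f (end x) ∙ ζ′ x ∈ rightCoset G (⟨ωD⟩ (inv x)) (ζ x ∙ f (beg x)))
    where
    private
      module OnV = CosetTranslation V G ωV ωV-cong f f-cong
      module OnD = CosetTranslation D G ωD ωD-cong (f ∘ beg) (f-cong ∘ beg-cong)

    -- Here `m` is the discrepancy between `ζ′` and the exact transform. Conjugation by `m`
    -- preserves ω(x⁻¹), so the new conjugacy condition reduces to `ωD-conj`.
    ▷-gauge : ∀ x a → let m , _ = f∙ζ′ x in
              f (end x) ▷ ζ′ x ▷ a ≈ m ▷ ζ x ▷ f (beg x) ▷ a
    ▷-gauge x a = let m , _ , eq = f∙ζ′ x in begin
      f (end x) ▷ ζ′ x ▷ a               ≈⟨ ▷-comp _ _ a ⟨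
      (f (end x) ∙ ζ′ x) ▷ a             ≈⟨ ▷-cong eq refl ⟩
      (m ∙ (ζ x ∙ f (beg x))) ▷ a        ≈⟨ ▷-comp _ _ a ⟩
      m ▷ (ζ x ∙ f (beg x)) ▷ a          ≈⟨ ▷-cong refl (▷-comp _ _ a) ⟩
      m ▷ ζ x ▷ f (beg x) ▷ a            ∎

    ωD′-conj : ∀ x → Subgroup.set (OnD.ω′ x) ≐ conjugate G (Subgroup.set (OnD.ω′ (inv x))) (ζ′ x)
    ωD′-conj x =
      (λ {a} a∈ → let m , m∈ , _ = f∙ζ′ x in ∈-conjugate⁺ (OnD.ω′ (inv x))
         (Subgroup.resp (ωD (inv x)) (sym (▷-gauge x a))
           (▷-closed (ωD (inv x)) m∈ (∈-conjugate⁻ (ωD (inv x)) (proj₁ (ωD-conj x) a∈))))) ,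
      (λ {a} a∈ → let m , m∈ , _ = f∙ζ′ x in proj₂ (ωD-conj x)
         (∈-conjugate⁺ (ωD (inv x)) (▷-closed⁻ (ωD (inv x)) m∈
           (Subgroup.resp (ωD (inv x)) (▷-gauge x a) (∈-conjugate⁻ (OnD.ω′ (inv x)) a∈)))))

    -- Conjugated by f(beg x), the product becomes k · ζ(x⁻¹)ζ(x) · n, where `k` is the discrepancy
    -- at x⁻¹ and `n` comes from the discrepancy `m` at x. All three factors lie in ω(x).
    ζ′-inv : ∀ x → ζ′ (inv x) ∙ ζ′ x ∈ Subgroup.set (OnD.ω′ x)
    ζ′-inv x =
      let m , m∈ , eqm = f∙ζ′ x
          k , k∈ , eqk = f∙ζ′ (inv x)
          -- `m` arises to the left of `ζ x`; moved to its right it becomes `n`, which `ωD-conj`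
          -- places in ω(x).
          n = ζ x ⁻¹ ▷ m
          n∈ = proj₂ (ωD-conj x) (∈-conjugate⁺ (ωD (inv x))
                 (Subgroup.resp (ωD (inv x)) (sym (z▷z⁻¹▷a≈a (ζ x) m)) m∈))
          ζn≈mζ = begin
            ζ x ∙ n            ≈⟨ z▷a∙z≈za (ζ x) n ⟨
            ζ x ▷ n ∙ ζ x      ≈⟨ ∙-congʳ (z▷z⁻¹▷a≈a (ζ x) m) ⟩
            m ∙ ζ x            ∎
          u = f (beg x)
          w = f (end x)
          x⁻¹⁻¹≈x = inv-involutive x
      in Subgroup.resp (ωD x)
        (sym (za≈bz⇒z▷a≈b (begin
          u ∙ (ζ′ (inv x) ∙ ζ′ x)                   ≈⟨ assoc _ _ _ ⟨
          u ∙ ζ′ (inv x) ∙ ζ′ x                     ≈⟨ ∙-congʳ (∙-congʳ (f-cong (beg-cong x⁻¹⁻¹≈x))) ⟨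
          f (end (inv x)) ∙ ζ′ (inv x) ∙ ζ′ x       ≈⟨ ∙-congʳ eqk ⟩
          k ∙ (ζ (inv x) ∙ w) ∙ ζ′ x                ≈⟨ ∙-congʳ (assoc _ _ _) ⟨
          k ∙ ζ (inv x) ∙ w ∙ ζ′ x                  ≈⟨ assoc _ _ _ ⟩
          k ∙ ζ (inv x) ∙ (w ∙ ζ′ x)                ≈⟨ ∙-congˡ eqm ⟩
          k ∙ ζ (inv x) ∙ (m ∙ (ζ x ∙ u))           ≈⟨ ∙-congˡ (assoc _ _ _) ⟨
          k ∙ ζ (inv x) ∙ (m ∙ ζ x ∙ u)             ≈⟨ ∙-congˡ (∙-congʳ ζn≈mζ) ⟨
          k ∙ ζ (inv x) ∙ (ζ x ∙ n ∙ u)             ≈⟨ assoc _ _ _ ⟨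
          k ∙ ζ (inv x) ∙ (ζ x ∙ n) ∙ u             ≈⟨ ∙-congʳ (assoc _ _ _) ⟨
          k ∙ ζ (inv x) ∙ ζ x ∙ n ∙ u               ≈⟨ ∙-congʳ (∙-congʳ (assoc _ _ _)) ⟩
          k ∙ (ζ (inv x) ∙ ζ x) ∙ n ∙ u             ∎)))
        (Subgroup.∙-closed (ωD x)
          (Subgroup.∙-closed (ωD x) (proj₁ (ωD-cong x⁻¹⁻¹≈x) k∈) (ζ-inv x)) n∈)

    transformed : GenVoltageGraph Δ G s
    transformed = record
      { connected = connected
      ; ωV        = OnV.ω′
      ; ωD        = OnD.ω′
      ; ζ         = ζ′
      ; ωV-cong   = OnV.ω′-cong
      ; ωD-cong   = OnD.ω′-cong
      ; ζ-cong    = ζ′-cong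
      -- The weights of x and of its beginning are conjugated by the same element, so the old
      -- inclusion applies to the conjugated element.
      ; ωD⊆ωV     = λ x → ωD⊆ωV x
      ; ωD-conj   = ωD′-conj
      ; ζ-inv     = ζ′-inv
      }

    -- Compares inverting then translating with translating then inverting. The two differ by a
    -- conjugate of m⁻¹, which the new weight of x⁻¹ absorbs.
    translate-ζ : ∀ x g → f (end x) ⁻¹ ∙ (ζ x ∙ g) ∈
             rightCoset G (Subgroup.set (OnD.ω′ (inv x))) (ζ′ x ∙ (f (beg x) ⁻¹ ∙ g))
    translate-ζ x g =
      let m , m∈ , eq = f∙ζ′ x
          u = f (beg x)
          w = f (end x)
          k , k∈ , e = ∈-rightCoset-^⁺ (ωD (inv x)) {w} {w}
            {ζ x ∙ g} {w ∙ (ζ′ x ∙ (u ⁻¹ ∙ g))} refl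
            (m ⁻¹ , Subgroup.⁻¹-closed (ωD (inv x)) m∈ , (begin
              ζ x ∙ g                                     ≈⟨ ∙-congˡ (\\-leftDividesˡ u g) ⟨
              ζ x ∙ (u ∙ (u ⁻¹ ∙ g))                      ≈⟨ assoc _ _ _ ⟨
              ζ x ∙ u ∙ (u ⁻¹ ∙ g)                        ≈⟨ ∙-congʳ (\\-leftDividesʳ m _) ⟨
              m ⁻¹ ∙ (m ∙ (ζ x ∙ u)) ∙ (u ⁻¹ ∙ g)         ≈⟨ ∙-congʳ (∙-congˡ eq) ⟨
              m ⁻¹ ∙ (w ∙ ζ′ x) ∙ (u ⁻¹ ∙ g)              ≈⟨ assoc _ _ _ ⟩
              m ⁻¹ ∙ (w ∙ ζ′ x ∙ (u ⁻¹ ∙ g))              ≈⟨ ∙-congˡ (assoc _ _ _) ⟩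
              m ⁻¹ ∙ (w ∙ (ζ′ x ∙ (u ⁻¹ ∙ g)))            ∎))
      in k , k∈ , trans e (∙-congˡ (\\-leftDividesʳ w _))

    GenCov≅ : GenCov 𝒱 ≅ GenCov transformed
    GenCov≅ = record
      { onV = record
          { to        = OnV.translate
          ; cong      = OnV.translate-cong
          ; bijective = OnV.translate-bijective }
      ; onD = record
          { to        = OnD.translate
          ; cong      = OnD.translate-cong
          ; bijective = OnD.translate-bijective }
      ; beg-commutes = λ _ → V.refl , (λ a∈ → a∈) , (λ a∈ → a∈)
      ; inv-commutes = λ (x , g) → D.refl ,
          rightCoset-≐⁺ G (OnD.ω′ (inv x)) (OnD.ω′ (inv x)) (OnD.ω′-cong D.refl) (translate-ζ x g)
      }

-- The potential of a spanning tree.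

module TreePotential
  {v ℓv d ℓd c ℓ s p q} (em : ExcludedMiddle ℓd) {Δ : Graph v ℓv d ℓd} {G : Group c ℓ}
  (𝒱 : GenVoltageGraph Δ G s) (T : Subgraph Δ p q) (T-tree : Subgraph.IsSpanningTree T)
  where
  open Graph Δ
  open Group G
  open GenVoltageGraph 𝒱
  open Subgraph T
  open GroupProperties G
  open SetoidReasoning setoid
  private module T = Graph toGraph
  open ReducedWalks toGraph

  _≟_ : Decidable T.D._≈_
  _ ≟ _ = em

  spanning : Spanning
  spanning = proj₁ T-tree

  root : T.V.Carrier
  root = T.nonempty

  toRoot : T.V.Carrier → List T.D.Carrier
  toRoot u = reduce _≟_ (proj₁ (proj₁ (proj₂ T-tree) u root))

  toRoot-walk : ∀ u → T.IsWalk u (toRoot u) root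
  toRoot-walk u = reduce-walk _≟_ (proj₂ (proj₁ (proj₂ T-tree) u root))

  toRoot-reduced : ∀ u → Reduced (toRoot u)
  toRoot-reduced u = reduce-reduced _≟_ (proj₁ (proj₁ (proj₂ T-tree) u root))

  toRoot-unique : ∀ {u xs} → T.IsWalk u xs root → Reduced xs → Pointwise T.D._≈_ (toRoot u) xs
  toRoot-unique = reducedWalk-unique _≟_ (proj₂ (proj₂ T-tree)) (toRoot-walk _) (toRoot-reduced _)

  -- Voltages in `GenCov` multiply on the left, so for a walk to the root this is the total voltage
  -- of the reverse walk, from the root.
  walkVoltage : List T.D.Carrier → Carrier
  walkVoltage []             = ε
  walkVoltage ((x , _) ∷ xs) = ζ (inv x) ∙ walkVoltage xs

  walkVoltage-cong : ∀ {xs ys} → Pointwise T.D._≈_ xs ys → walkVoltage xs ≈ walkVoltage ys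
  walkVoltage-cong []            = refl
  walkVoltage-cong (x≈y ∷ xs≈ys) = ∙-cong (ζ-cong (inv-cong x≈y)) (walkVoltage-cong xs≈ys)

  potentialT : T.V.Carrier → Carrier
  potentialT u = walkVoltage (toRoot u)

  potentialT-cong : ∀ {u w} → u T.V.≈ w → potentialT u ≈ potentialT w
  potentialT-cong {u} {w} u≈w = walkVoltage-cong
    (toRoot-unique {u} (walk-respˡ (T.V.sym {u} {w} u≈w) (toRoot-walk w)) (toRoot-reduced w))

  -- A disjunction because ζ(x⁻¹)ζ(x) need not be 1. A cancelled dart is x⁻¹, and it had contributed
  -- the voltage of its own inverse, ζ(x).
  walkVoltage-cons : ∀ (x@(x₀ , _) : T.D.Carrier) xs →
    walkVoltage (cons _≟_ x xs) ≈ ζ (inv x₀) ∙ walkVoltage xs ⊎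
    walkVoltage xs ≈ ζ x₀ ∙ walkVoltage (cons _≟_ x xs)
  walkVoltage-cons x [] = inj₁ refl
  walkVoltage-cons x@(x₀ , _) (y ∷ ys) with y ≟ T.inv x
  ... | yes y≈x⁻¹ = inj₂ (∙-congʳ (ζ-cong (D.trans (inv-cong y≈x⁻¹) (inv-involutive x₀))))
  ... | no _      = inj₁ refl

  potential : V.Carrier → Carrier
  potential u = potentialT (u , spanning u)

  potential-cong : ∀ {u w} → u V.≈ w → potential u ≈ potential w
  potential-cong {u} {w} = potentialT-cong {u , spanning u} {w , spanning w}

  potential-end : ∀ {x} → x ∈ DS →
    potential (end x) ∈ rightCoset G (⟨ωD⟩ (inv x)) (ζ x ∙ potential (beg x))
  potential-end {x} x∈ =
    [ (λ eq → farther (trans fbeg eq)) , (λ eq → closer (trans eq (∙-congˡ (sym fbeg)))) ]′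
      (walkVoltage-cons (x , x∈) (toRoot w₀))
    where
    u₀ w₀ : T.V.Carrier
    u₀ = beg x , spanning (beg x)
    w₀ = end x , spanning (end x)

    w : Carrier
    w = potential (end x)

    -- Prepending `x` with cancellation gives a reduced walk from `beg x` to the root, which
    -- uniqueness identifies with the chosen one.
    fbeg : potential (beg x) ≈ walkVoltage (cons _≟_ (x , x∈) (toRoot w₀))
    fbeg = walkVoltage-cong (toRoot-unique {u₀}
      -- The end of the tree dart and `w₀` differ only in their membership proofs, which equality in
      -- the tree ignores.
      (cons-walk _≟_ {x = x , x∈} V.refl (walk-respˡ V.refl (toRoot-walk w₀)))
      (cons-reduced _≟_ {x , x∈} (toRoot-reduced w₀)))

    farther : potential (beg x) ≈ ζ (inv x) ∙ w →
              w ∈ rightCoset G (⟨ωD⟩ (inv x)) (ζ x ∙ potential (beg x))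
    -- `ζ-inv` at `inv x`, rewritten by x⁻¹⁻¹ = x, puts ζ(x)ζ(x⁻¹) in ω(x⁻¹).
    farther eq = (ζ x ∙ ζ (inv x)) ⁻¹ ,
      Subgroup.⁻¹-closed (ωD (inv x))
        (Subgroup.resp (ωD (inv x)) (∙-congʳ (ζ-cong (inv-involutive x))) (ζ-inv (inv x))) ,
      (begin
        w                                                 ≈⟨ \\-leftDividesʳ _ w ⟨
        (ζ x ∙ ζ (inv x)) ⁻¹ ∙ (ζ x ∙ ζ (inv x) ∙ w)      ≈⟨ ∙-congˡ (assoc _ _ _) ⟩
        (ζ x ∙ ζ (inv x)) ⁻¹ ∙ (ζ x ∙ (ζ (inv x) ∙ w))    ≈⟨ ∙-congˡ (∙-congˡ eq) ⟨
        (ζ x ∙ ζ (inv x)) ⁻¹ ∙ (ζ x ∙ potential (beg x))  ∎)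

    closer : w ≈ ζ x ∙ potential (beg x) →
             w ∈ rightCoset G (⟨ωD⟩ (inv x)) (ζ x ∙ potential (beg x))
    closer eq = ε , Subgroup.ε-closed (ωD (inv x)) , trans eq (sym (identityˡ _))

theorem26 : (∀ (a : Level) → ExcludedMiddle a) →
    ∀ {v ℓv d ℓd c ℓ s p q : Level}
    (Δ : Graph v ℓv d ℓd) (G : Group c ℓ) (𝒱 : GenVoltageGraph Δ G s)
    (T : Subgraph Δ p q) → Subgraph.IsSpanningTree T →
    Σ[ 𝒱′ ∈ GenVoltageGraph Δ G s ]
    (∀ x → x ∈ Subgraph.DS T → Group._≈_ G (GenVoltageGraph.ζ 𝒱′ x) (Group.ε G)) ×
    GenCov 𝒱 ≅ GenCov 𝒱′
theorem26 em Δ G 𝒱 T T-tree =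
  transformed , ζ′-tree , GenCov≅
  where
  open Graph Δ
  open Group G
  open GenVoltageGraph 𝒱
  open Subgraph T
  open GroupProperties G
  open TreePotential (em _) 𝒱 T T-tree

  ζ′ : D.Carrier → Carrier
  ζ′ x with em _ {x ∈ DS}
  ... | yes _ = ε
  ... | no _  = potential (end x) ⁻¹ ∙ (ζ x ∙ potential (beg x))

  ζ′-cong : ∀ {x y} → x D.≈ y → ζ′ x ≈ ζ′ y
  ζ′-cong {x} {y} x≈y with em _ {x ∈ DS} | em _ {y ∈ DS}
  ... | yes _  | yes _  = refl
  ... | yes x∈ | no y∉  = contradiction (DS-resp x≈y x∈) y∉
  ... | no x∉  | yes y∈ = contradiction (DS-resp (D.sym x≈y) y∈) x∉
  ... | no _   | no _   = ∙-cong (⁻¹-cong (potential-cong (beg-cong (inv-cong x≈y))))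
                                 (∙-cong (ζ-cong x≈y) (potential-cong (beg-cong x≈y)))

  ζ′-tree : ∀ x → x ∈ DS → ζ′ x ≈ ε
  ζ′-tree x x∈ with em _ {x ∈ DS}
  ... | yes _ = refl
  ... | no x∉ = contradiction x∈ x∉

  -- On the tree the discrepancy is the one found in `potential-end`; off the tree `ζ′` is the exact
  -- transform and the discrepancy is `ε`.
  f∙ζ′ : ∀ x → potential (end x) ∙ ζ′ x ∈ rightCoset G (⟨ωD⟩ (inv x)) (ζ x ∙ potential (beg x))
  f∙ζ′ x with em _ {x ∈ DS}
  ... | yes x∈ = let m , m∈ , eq = potential-end x∈ in m , m∈ , trans (identityʳ _) eq
  ... | no _   = ε , Subgroup.ε-closed (ωD (inv x)) ,
                 trans (\\-leftDividesˡ (potential (end x)) _) (sym (identityˡ _))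

  open Gauge.Transform 𝒱 potential potential-cong ζ′ ζ′-cong f∙ζ′
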